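{- There is an algorithm that solves Balanced Vertex in ${\cal O}(n)$ time on instances $(G,\pi,S)$ where $G$ is a clique (complete graph) with $n$ vertices.
   Context: All graphs are finite, simple, connected, with unit-length edges; $d(u,v)$ is the shortest-path distance. A proper vertex list is a list $S=(s_1,\ldots,s_p)$ of pairwise different vertices; $d(v,S)=\min_i d(v,s_i)$. The (prioritized) Voronoi diagram of $G=(V,E)$ with respect to $S$ is the partition of $V$ into territories $\mathbb{T}(s_1,S),\ldots,\mathbb{T}(s_p,S)$ where $v\in\mathbb{T}(s_i,S)$ if and only if $d(v,s_i)=d(v,S)$ and $d(v,s_j)>d(v,S)$ for every $j$ with $1\le j<i$. For a cost function $\pi:V\to\mathbb{R}_{\ge 0}$, the load of $s_i$ is $\ell_\pi(s_i,S)=\sum_{v\in\mathbb{T}(s_i,S)}\pi(v)$, and $L_\pi(S)=\max_i \ell_\pi(s_i,S)$. For $v\in V\setminus S$, $S+v=(s_1,\ldots,s_p,v)$. Balanced Vertex: given a graph $G=(V,E)$, a cost function $\pi:V\to\mathbb{R}_{\ge 0}$ and a proper vertex list $S$, output a vertex $v\in V\setminus S$ such that $L_\pi(S+v)$ is minimized. Running times are worst-case, in the usual unit-cost RAM model. -}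

module Defs where

open import Level using (0ℓ)
open import Axiom.ExcludedMiddle using (ExcludedMiddle)
open import Data.Nat.Base as ℕ using (ℕ; zero; suc; _∸_; _⊓_)
import Data.Nat.Properties as ℕₚ
open import Data.Fin.Base as Fin using (Fin; toℕ)
import Data.Fin.Properties as Finₚ
open import Data.Rational.Base as ℚ using (ℚ; 0ℚ; 1ℚ)
import Data.Rational.Properties as ℚₚ
open import Data.Bool.Base using (if_then_else_)
open import Data.List.Base as List using (List; []; _∷_; _++_; allFin; concatMap)
open import Data.Maybe.Base using (Maybe; just; nothing)
open import Data.Vec.Base as Vec using (Vec; _∷ʳ_; lookup; tabulate; foldr₁; toList)
open import Data.Vec.Membership.Propositional using (_∉_)
open import Data.Vec.Relation.Unary.Unique.Propositional using (Unique)
open import Data.Product.Base using (∃; _×_; _,_; proj₁; proj₂)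
open import Data.Sum.Base using (_⊎_; inj₁; inj₂; [_,_]′)
open import Relation.Nullary using (¬_; Dec; yes; no; does)
open import Relation.Nullary.Decidable using (_×-dec_; _→-dec_; from-yes)
open import Relation.Binary.Definitions using (Decidable; tri<; tri≈; tri>)
open import Relation.Binary.PropositionalEquality
  using (_≡_; _≢_; refl; sym; trans; cong; subst)

------------------------------------------------------------------------
-- Real numbers

-- A real number is its set of strictly smaller rationals.  Under excluded
-- middle these one-sided cuts are exactly the Dedekind reals; without it they
-- are more general, so the order is only known to be total classically.

record ℝ : Set₁ where
  field
    Cut       : ℚ → Set
    inhabited : ∃ λ q → Cut q
    bounded   : ∃ λ q → ¬ Cut q
    lower     : ∀ {p q} → p ℚ.< q → Cut q → Cut p
    rounded   : ∀ {p} → Cut p → ∃ λ q → p ℚ.< q × Cut q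

open ℝ public

infix  4 _≤ᴿ_
infixl 6 _+ᴿ_ _⊔ᴿ_

_≤ᴿ_ : ℝ → ℝ → Set
x ≤ᴿ y = ∀ q → Cut x q → Cut y q

private
  Cut-≤ : ∀ x {p q} → p ℚ.≤ q → Cut x q → Cut x p
  Cut-≤ x {p} {q} p≤q cq with ℚₚ.<-cmp p q
  ... | tri< p<q _ _    = lower x p<q cq
  ... | tri≈ _ refl _   = cq
  ... | tri> _ _ q<p    with () ← ℚₚ.<-irrefl refl (ℚₚ.≤-<-trans p≤q q<p)

  ∉⇒< : ∀ x {p q} → ¬ Cut x p → Cut x q → q ℚ.< p
  ∉⇒< x {p} {q} ¬cp cq with ℚₚ.<-cmp q p
  ... | tri< q<p _ _    = q<p
  ... | tri≈ _ refl _   with () ← ¬cp cq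
  ... | tri> _ _ p<q    with () ← ¬cp (lower x p<q cq)

  [a-b]+b : ∀ a b → (a ℚ.+ ℚ.- b) ℚ.+ b ≡ a
  [a-b]+b a b = trans (ℚₚ.+-assoc a (ℚ.- b) b)
    (trans (cong (a ℚ.+_) (ℚₚ.+-inverseˡ b)) (ℚₚ.+-identityʳ a))

  [a+b]-b : ∀ a b → (a ℚ.+ b) ℚ.+ ℚ.- b ≡ a
  [a+b]-b a b = trans (ℚₚ.+-assoc a b (ℚ.- b))
    (trans (cong (a ℚ.+_) (ℚₚ.+-inverseʳ b)) (ℚₚ.+-identityʳ a))

0ᴿ : ℝ
0ᴿ = record
  { Cut       = ℚ._< 0ℚ
  ; inhabited = ℚ.- 1ℚ , from-yes (ℚ.- 1ℚ ℚₚ.<? 0ℚ)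
  ; bounded   = 0ℚ , ℚₚ.<-irrefl refl
  ; lower     = ℚₚ.<-trans
  ; rounded   = λ p<0 → let q , p<q , q<0 = ℚₚ.<-dense p<0 in q , p<q , q<0
  }

_+ᴿ_ : ℝ → ℝ → ℝ
x +ᴿ y = record
  { Cut       = λ r → ∃ λ p → ∃ λ q → Cut x p × Cut y q × r ≡ p ℚ.+ q
  ; inhabited = let p , cp = inhabited x ; q , cq = inhabited y
                in p ℚ.+ q , p , q , cp , cq , refl
  ; bounded   = let p , ¬cp = bounded x ; q , ¬cq = bounded y
                in p ℚ.+ q , λ (a , b , ca , cb , eq) →
                   ℚₚ.<-irrefl (sym eq) (ℚₚ.+-mono-< (∉⇒< x ¬cp ca) (∉⇒< y ¬cq cb))
  ; lower     = λ { {r} r<p+q (p , q , cp , cq , refl) →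
                   r ℚ.+ ℚ.- q , q
                   , lower x (subst (r ℚ.+ ℚ.- q ℚ.<_) ([a+b]-b p q)
                                    (ℚₚ.+-monoˡ-< (ℚ.- q) r<p+q)) cp
                   , cq , sym ([a-b]+b r q) }
  ; rounded   = λ { (p , q , cp , cq , refl) →
                   let p′ , p<p′ , cp′ = rounded x cp
                   in p′ ℚ.+ q , ℚₚ.+-monoˡ-< q p<p′ , p′ , q , cp′ , cq , refl }
  }

_⊔ᴿ_ : ℝ → ℝ → ℝ
x ⊔ᴿ y = record
  { Cut       = λ q → Cut x q ⊎ Cut y q
  ; inhabited = let p , cp = inhabited x in p , inj₁ cp
  ; bounded   = bound
  ; lower     = λ p<q → [ (λ c → inj₁ (lower x p<q c)) , (λ c → inj₂ (lower y p<q c)) ]′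
  ; rounded   = [ (λ c → let q , p<q , cq = rounded x c in q , p<q , inj₁ cq)
                , (λ c → let q , p<q , cq = rounded y c in q , p<q , inj₂ cq) ]′
  }
  where
  bound : ∃ λ q → ¬ (Cut x q ⊎ Cut y q)
  bound with bounded x | bounded y
  ... | p , ¬cp | q , ¬cq with ℚₚ.≤-total p q
  ... | inj₁ p≤q = q , [ (λ c → ¬cp (Cut-≤ x p≤q c)) , ¬cq ]′
  ... | inj₂ q≤p = p , [ ¬cp , (λ c → ¬cq (Cut-≤ y q≤p c)) ]′

sumᴿ : List ℝ → ℝ
sumᴿ = List.foldr _+ᴿ_ 0ᴿ

------------------------------------------------------------------------
-- Graphs and distances

module _ {n : ℕ} (Adj : Fin n → Fin n → Set) where

  -- Walk k u v: there is a walk with exactly k edges from u to v.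
  Walk : ℕ → Fin n → Fin n → Set
  Walk zero    u v = u ≡ v
  Walk (suc k) u v = ∃ λ w → Adj u w × Walk k w v

  walk? : Decidable Adj → ∀ k u v → Dec (Walk k u v)
  walk? adj? zero    u v = u Finₚ.≟ v
  walk? adj? (suc k) u v = Finₚ.any? λ w → adj? u w ×-dec walk? adj? k w v

record Graph (n : ℕ) : Set₁ where
  field
    Adj       : Fin n → Fin n → Set
    adj?      : Decidable Adj
    symmetric : ∀ {u v} → Adj u v → Adj v u
    loopless  : ∀ {v} → ¬ Adj v v
    connected : ∀ u v → ∃ λ k → Walk Adj k u v

open Graph public

IsClique : ∀ {n} → Graph n → Set
IsClique G = ∀ {u v} → u ≢ v → Adj G u v

-- The least k ≤ b satisfying P, if there is one (and b otherwise).
leastUpTo : {P : ℕ → Set} → (∀ k → Dec (P k)) → (b : ℕ) → ℕ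
leastUpTo P? zero    = zero
leastUpTo P? (suc b) =
  if does (P? zero) then zero else suc (leastUpTo (λ k → P? (suc k)) b)

-- Some walk from u to v is given by connectedness, so the search up to its
-- length succeeds and finds the length of a shortest one.
dist : ∀ {n} → Graph n → Fin n → Fin n → ℕ
dist G u v =
  leastUpTo (λ k → walk? (Adj G) (adj? G) k u v) (proj₁ (connected G u v))

------------------------------------------------------------------------
-- Prioritized Voronoi diagrams and loads

module _ {n : ℕ} (G : Graph n) where

  distToSites : ∀ {p} → Fin n → Vec (Fin n) (suc p) → ℕ
  distToSites v S = foldr₁ _⊓_ (Vec.map (dist G v) S)

  InTerritory : ∀ {p} → Vec (Fin n) (suc p) → Fin (suc p) → Fin n → Set
  InTerritory S i v =
    dist G v (lookup S i) ≡ distToSites v S ×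
    (∀ j → j Fin.< i → distToSites v S ℕ.< dist G v (lookup S j))

  inTerritory? : ∀ {p} (S : Vec (Fin n) (suc p)) i v → Dec (InTerritory S i v)
  inTerritory? S i v =
    dist G v (lookup S i) ℕₚ.≟ distToSites v S ×-dec
    Finₚ.all? λ j → j Finₚ.<? i →-dec distToSites v S ℕₚ.<? dist G v (lookup S j)

  load : ∀ {p} → (Fin n → ℝ) → Vec (Fin n) (suc p) → Fin (suc p) → ℝ
  load π S i = sumᴿ (List.map π (List.filter (inTerritory? S i) (allFin n)))

  maxLoad : ∀ {p} → (Fin n → ℝ) → Vec (Fin n) (suc p) → ℝ
  maxLoad π S = foldr₁ _⊔ᴿ_ (tabulate (load π S))

------------------------------------------------------------------------
-- The Balanced Vertex problem

record Instance (n p : ℕ) : Set₁ where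
  field
    graph       : Graph n
    cost        : Fin n → ℝ
    cost≥0      : ∀ v → 0ᴿ ≤ᴿ cost v
    sites       : Vec (Fin n) p
    distinct    : Unique sites
    -- There is a vertex to output.
    hasNonSite  : ∃ λ v → v ∉ sites

open Instance public

-- sites ∷ʳ v is the list S + v.
IsBalancedVertex : ∀ {n p} → Instance n p → Fin n → Set
IsBalancedVertex I v =
  v ∉ sites I ×
  (∀ w → w ∉ sites I →
    maxLoad (graph I) (cost I) (sites I ∷ʳ v) ≤ᴿ
    maxLoad (graph I) (cost I) (sites I ∷ʳ w))

------------------------------------------------------------------------
-- Unit-cost random access machine

-- There are registers and indirectly addressed memory cells, both for natural
-- numbers and for reals.  On reals only moving, adding and comparing are
-- possible, and naturals cannot be multiplied in one step, so that a time
-- bound here is also one for machines with richer arithmetic.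

data Instr : Set where
  -- natural-number registers (arguments are register indices, except that
  -- the second argument of const is the constant itself)
  const move       : (d k : ℕ) → Instr
  add sub          : (d a b : ℕ) → Instr
  loadN            : (d a : ℕ) → Instr      -- d := memory[a]
  storeN           : (a s : ℕ) → Instr      -- memory[a] := s
  -- real registers; addresses are taken from natural-number registers
  moveR            : (d a : ℕ) → Instr
  addR             : (d a b : ℕ) → Instr
  loadR            : (d a : ℕ) → Instr
  storeR           : (a s : ℕ) → Instr
  -- control; target is a position in the program
  jump             : (target : ℕ) → Instr
  jump≤ jump≤R     : (a b target : ℕ) → Instr
  halt             : Instr

Program : Set
Program = List Instr

record State : Set₁ where
  constructor state
  field
    pc   : ℕ
    regN : ℕ → ℕ
    regR : ℕ → ℝ
    memN : ℕ → ℕ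
    memR : ℕ → ℝ

open State public

_[_≔_] : ∀ {ℓ} {A : Set ℓ} → (ℕ → A) → ℕ → A → (ℕ → A)
(f [ i ≔ x ]) j = if does (j ℕₚ.≟ i) then x else f j

nth : ∀ {ℓ} {A : Set ℓ} → A → List A → ℕ → A
nth default []       _       = default
nth default (x ∷ _)  zero    = x
nth default (_ ∷ xs) (suc i) = nth default xs i

-- Deciding the order of the reals is a primitive of the machine.
module Execution (_≤ᴿ?_ : Decidable _≤ᴿ_) where

  exec : Instr → State → Maybe State
  exec (const d k)     (state c N R M Q) = just (state (suc c) (N [ d ≔ k ]) R M Q)
  exec (move d a)      (state c N R M Q) = just (state (suc c) (N [ d ≔ N a ]) R M Q)
  exec (add d a b)     (state c N R M Q) = just (state (suc c) (N [ d ≔ N a ℕ.+ N b ]) R M Q)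
  exec (sub d a b)     (state c N R M Q) = just (state (suc c) (N [ d ≔ N a ∸ N b ]) R M Q)
  exec (loadN d a)     (state c N R M Q) = just (state (suc c) (N [ d ≔ M (N a) ]) R M Q)
  exec (storeN a s)    (state c N R M Q) = just (state (suc c) N R (M [ N a ≔ N s ]) Q)
  exec (moveR d a)     (state c N R M Q) = just (state (suc c) N (R [ d ≔ R a ]) M Q)
  exec (addR d a b)    (state c N R M Q) = just (state (suc c) N (R [ d ≔ R a +ᴿ R b ]) M Q)
  exec (loadR d a)     (state c N R M Q) = just (state (suc c) N (R [ d ≔ Q (N a) ]) M Q)
  exec (storeR a s)    (state c N R M Q) = just (state (suc c) N R M (Q [ N a ≔ R s ]))
  exec (jump t)        (state c N R M Q) = just (state t N R M Q)
  exec (jump≤ a b t)   (state c N R M Q) =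
    just (state (if does (N a ℕₚ.≤? N b) then t else suc c) N R M Q)
  exec (jump≤R a b t)  (state c N R M Q) =
    just (state (if does (R a ≤ᴿ? R b) then t else suc c) N R M Q)
  exec halt            _                 = nothing

  -- Leaving the program counts as halting.
  step : Program → State → Maybe State
  step P σ = exec (nth halt P (pc σ)) σ

  -- P ⊢ σ ⇓[ t ] τ: started in σ, the program halts in τ after t instructions.
  data _⊢_⇓[_]_ (P : Program) : State → ℕ → State → Set₁ where
    done : ∀ {σ} → step P σ ≡ nothing → P ⊢ σ ⇓[ 1 ] σ
    next : ∀ {σ σ′ t τ} → step P σ ≡ just σ′ → P ⊢ σ′ ⇓[ t ] τ → P ⊢ σ ⇓[ suc t ] τ

-- Input: n and p in registers 0 and 1; in the memory for naturals the sites,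
-- followed by the rows of the adjacency matrix; in the memory for reals the
-- costs.  Everything else is zero.
initial : ∀ {n p} → Instance n p → State
initial {n} {p} I = record
  { pc   = 0
  ; regN = nth 0 (n ∷ p ∷ [])
  ; regR = λ _ → 0ᴿ
  ; memN = nth 0 (List.map toℕ (toList (sites I)) ++ concatMap row (allFin n))
  ; memR = nth 0ᴿ (List.map (cost I) (allFin n))
  }
  where
  row : Fin n → List ℕ
  row u = List.map (λ v → if does (adj? (graph I) u v) then 1 else 0) (allFin n)

-- On the instance I the program halts within T steps, and register 0 then
-- contains an optimal vertex.
SolvesWithin : ExcludedMiddle 0ℓ → Program → ∀ {n p} → Instance n p → ℕ → Set₁
SolvesWithin em P I T =
  ∃ λ t → ∃ λ τ → P ⊢ initial I ⇓[ t ] τ × t ℕ.≤ T ×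
    (∃ λ v → regN τ 0 ≡ toℕ v × IsBalancedVertex I v)
  where open Execution (λ x y → em {x ≤ᴿ y})

{-# OPTIONS --safe #-}

-- In a clique the first site owns itself and all non-sites, and every other
-- site owns only itself.  Hence, writing A_v for the load of s_1 in S + v, the
-- loads of S + v are A_v, π(v) and values not depending on v.  Let v have
-- maximal cost among the non-sites and let w be another non-site.  Since A_v
-- and A_w differ by exchanging π(w) and π(v), A_v ≤ A_w; and π(v) ≤ A_w because
-- s_1 owns v in S + w.  So v is optimal, and it is found in linear time by
-- marking the sites and scanning the vertices.  If S is empty, v owns everything
-- and any choice is optimal.

module Submission where

open import Defs
open import Level using (0ℓ)
open import Axiom.ExcludedMiddle using (ExcludedMiddle)
open import Algebra.Bundles using (CommutativeMonoid)
open import Algebra.Properties.CommutativeSemigroup using (x∙yz≈y∙xz)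
open import Algebra.Properties.Group using (//-rightDividesˡ)
open import Data.Bool.Base using (true; false; if_then_else_)
open import Data.Fin.Base as Fin using (Fin; zero; suc; toℕ; fromℕ<)
import Data.Fin.Properties as Finₚ
open import Data.List.Base as List using (List; []; _∷_; _++_; allFin)
open import Data.List.Membership.Propositional using (_∈_)
open import Data.List.Membership.Propositional.Properties using (∈-allFin)
open import Data.List.Properties using (filter-none)
open import Data.List.Relation.Unary.All as All using (All; []; _∷_)
import Data.List.Relation.Unary.All.Properties as Allₚ
open import Data.List.Relation.Unary.AllPairs using ([]; _∷_)
open import Data.List.Relation.Unary.Any using (here; there)
open import Data.List.Relation.Unary.Unique.Propositional using (Unique)
open import Data.List.Relation.Unary.Unique.Propositional.Properties using (allFin⁺)
open import Data.Maybe.Base using (just)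
open import Data.Nat.Base using (ℕ; zero; suc; _+_; _*_; _⊓_; _≤_; _<_; z≤n; s≤s)
import Data.Nat.Properties as ℕₚ
open import Data.Nat.Solver using (module +-*-Solver)
open import Data.Product.Base using (Σ; ∃; _×_; _,_; proj₁; proj₂)
import Data.Rational.Base as ℚ
import Data.Rational.Properties as ℚₚ
open import Data.Sum.Base as Sum using (_⊎_; inj₁; inj₂)
open import Data.Vec.Base as Vec using (Vec; []; _∷_; _∷ʳ_; lookup; tabulate; foldr₁; toList)
import Data.Vec.Membership.DecPropositional as DecMembership
open import Data.Vec.Membership.Propositional using (_∉_) renaming (_∈_ to _∈ᵛ_)
open import Data.Vec.Membership.Propositional.Properties using (∈-lookup)
open import Data.Vec.Properties using (lookup-map)
open import Data.Vec.Relation.Unary.Any as Anyᵛ using (here; there)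
import Data.Vec.Relation.Unary.Any.Properties as Anyᵛₚ
open import Data.Vec.Relation.Unary.Unique.Propositional.Properties using (lookup-injective)
open import Function.Base using (_∘_; id)
open import Relation.Nullary using (¬_; Dec; yes; no; does; contradiction)
open import Relation.Nullary.Decidable using (dec-true; dec-false; _×-dec_; ¬?)
open import Relation.Unary using (Pred)
import Relation.Unary as U
open import Relation.Binary.Definitions using (DecidableEquality; tri<; tri≈; tri>)
open import Relation.Binary.PropositionalEquality
  using (_≡_; _≢_; refl; sym; trans; cong; cong₂; subst; ≢-sym)

-- Real numbers

≤ᴿ-refl : ∀ x → x ≤ᴿ x
≤ᴿ-refl x q c = c

≤ᴿ-trans : ∀ x y z → x ≤ᴿ y → y ≤ᴿ z → x ≤ᴿ z
≤ᴿ-trans x y z x≤y y≤z q c = y≤z q (x≤y q c)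

-- If `r` is in the cut of `y` but not in that of `x`, everything in the cut of `x` is at most `r`,
-- hence in the cut of `y`. Excluded middle decides membership of `r` in the cut of `x`.
≰ᴿ⇒≥ᴿ : ExcludedMiddle 0ℓ → ∀ x y → ¬ x ≤ᴿ y → y ≤ᴿ x
≰ᴿ⇒≥ᴿ em x y x≰y r yr with em {Cut x r}
... | yes xr = xr
... | no ¬xr = contradiction x≤y x≰y
  where
  x≤y : x ≤ᴿ y
  x≤y q xq with ℚₚ.<-cmp q r
  ... | tri< q<r _ _  = lower y q<r yr
  ... | tri≈ _ refl _ = yr
  ... | tri> _ _ r<q  = contradiction (lower x r<q xq) ¬xr

+ᴿ-mono-≤ : ∀ x x′ y y′ → x ≤ᴿ x′ → y ≤ᴿ y′ → x +ᴿ y ≤ᴿ x′ +ᴿ y′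
+ᴿ-mono-≤ x x′ y y′ x≤ y≤ r (p , q , xp , yq , eq) = p , q , x≤ p xp , y≤ q yq , eq

-- Carries a term past the head of a sum. It is stated as an inequality because reals with the same
-- cut need not be propositionally equal.
+ᴿ-leftSwap : ∀ x y z → x +ᴿ (y +ᴿ z) ≤ᴿ y +ᴿ (x +ᴿ z)
+ᴿ-leftSwap x y z r (p , _ , xp , (q , s , yq , zs , refl) , refl) =
  q , p ℚ.+ s , yq , (p , s , xp , zs , refl) ,
  x∙yz≈y∙xz (CommutativeMonoid.commutativeSemigroup ℚₚ.+-0-commutativeMonoid) p q s

x≤ᴿx+y : ∀ x y → 0ᴿ ≤ᴿ y → x ≤ᴿ x +ᴿ y
x≤ᴿx+y x y 0≤y r xr =
  -- Splitting `r` as `r + 0` would fail for `y = 0ᴿ`, whose cut omits zero. Roundedness gives a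
  -- larger `r′` in the cut of `x`, so that the remainder `r - r′` is negative.
  let r′ , r<r′ , xr′ = rounded x xr
      r-r′<0 = subst (r ℚ.- r′ ℚ.<_) (ℚₚ.+-inverseʳ r′) (ℚₚ.+-monoˡ-< (ℚ.- r′) r<r′)
  in r′ , r ℚ.- r′ , xr′ , 0≤y _ r-r′<0 ,
     sym (trans (ℚₚ.+-comm r′ (r ℚ.- r′)) (//-rightDividesˡ ℚₚ.+-0-group r′ r))

y≤ᴿx+y : ∀ x y → 0ᴿ ≤ᴿ x → y ≤ᴿ x +ᴿ y
y≤ᴿx+y x y 0≤x r yr =
  let p , q , yp , xq , eq = x≤ᴿx+y y x 0≤x r yr
  in q , p , xq , yp , trans eq (ℚₚ.+-comm p q)

x+0≤ᴿx : ∀ x → x +ᴿ 0ᴿ ≤ᴿ x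
x+0≤ᴿx x r (p , q , xp , q<0 , refl) =
  lower x (subst (p ℚ.+ q ℚ.<_) (ℚₚ.+-identityʳ p) (ℚₚ.+-monoʳ-< p q<0)) xp

foldr₁-⊔ᴿ-upper : ∀ {p} (f : Fin (suc p) → ℝ) i → f i ≤ᴿ foldr₁ _⊔ᴿ_ (tabulate f)
foldr₁-⊔ᴿ-upper {zero}  f zero    q c = c
foldr₁-⊔ᴿ-upper {suc p} f zero    q c = inj₁ c
foldr₁-⊔ᴿ-upper {suc p} f (suc i) q c = inj₂ (foldr₁-⊔ᴿ-upper (f ∘ suc) i q c)

foldr₁-⊔ᴿ-least : ∀ {p} (f : Fin (suc p) → ℝ) b → (∀ i → f i ≤ᴿ b) →
                  foldr₁ _⊔ᴿ_ (tabulate f) ≤ᴿ b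
foldr₁-⊔ᴿ-least {zero}  f b f≤b q c        = f≤b zero q c
foldr₁-⊔ᴿ-least {suc p} f b f≤b q (inj₁ c) = f≤b zero q c
foldr₁-⊔ᴿ-least {suc p} f b f≤b q (inj₂ c) = foldr₁-⊔ᴿ-least (f ∘ suc) b (f≤b ∘ suc) q c

-- Sums of nonnegative reals over a decidable part of a list

module _ {A : Set} (π : A → ℝ) (π≥0 : ∀ x → 0ᴿ ≤ᴿ π x) where

  sumOver : {P : Pred A 0ℓ} → U.Decidable P → List A → ℝ
  sumOver P? xs = sumᴿ (List.map π (List.filter P? xs))

  module _ {P Q : Pred A 0ℓ} (P? : U.Decidable P) (Q? : U.Decidable Q) where

    private
      sP sQ : List A → ℝ
      sP = sumOver P?
      sQ = sumOver Q?

    sumOver-mono : ∀ {xs} → All (λ x → P x → Q x) xs → sP xs ≤ᴿ sQ xs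
    sumOver-mono []                 = ≤ᴿ-refl 0ᴿ
    sumOver-mono {x ∷ xs} (h ∷ hs) with P? x | Q? x
    ... | yes Px | yes Qx = +ᴿ-mono-≤ (π x) (π x) (sP xs) (sQ xs) (≤ᴿ-refl (π x)) (sumOver-mono hs)
    ... | yes Px | no ¬Qx = contradiction (h Px) ¬Qx
    ... | no _   | yes Qx = ≤ᴿ-trans (sP xs) (sQ xs) (π x +ᴿ sQ xs)
                              (sumOver-mono hs) (y≤ᴿx+y (π x) (sQ xs) (π≥0 x))
    ... | no _   | no _   = sumOver-mono hs

    -- In a list without duplicates at most one entry, `w`, can satisfy `P` but not `Q`; the extra
    -- `π w` pays for it. If no such entry occurs, the surplus is harmless by nonnegativity.
    sumOver-without : DecidableEquality A → ∀ {w} → (∀ {x} → x ≢ w → P x → Q x) →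
                      ∀ {xs} → Unique xs → sP xs ≤ᴿ π w +ᴿ sQ xs
    sumOver-without _≟_ {w} h []                       = y≤ᴿx+y (π w) 0ᴿ (π≥0 w)
    sumOver-without _≟_ {w} h {x ∷ xs} (x≢xs ∷ unique) with P? x | Q? x
    ... | yes Px | yes Qx = ≤ᴿ-trans (π x +ᴿ sP xs) (π x +ᴿ (π w +ᴿ sQ xs)) (π w +ᴿ (π x +ᴿ sQ xs))
                              (+ᴿ-mono-≤ (π x) (π x) (sP xs) (π w +ᴿ sQ xs) (≤ᴿ-refl (π x))
                                (sumOver-without _≟_ h unique))
                              (+ᴿ-leftSwap (π x) (π w) (sQ xs))
    ... | no _   | yes Qx = ≤ᴿ-trans (sP xs) (π w +ᴿ sQ xs) (π w +ᴿ (π x +ᴿ sQ xs))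
                              (sumOver-without _≟_ h unique)
                              (+ᴿ-mono-≤ (π w) (π w) (sQ xs) (π x +ᴿ sQ xs) (≤ᴿ-refl (π w))
                                (y≤ᴿx+y (π x) (sQ xs) (π≥0 x)))
    ... | no _   | no _   = sumOver-without _≟_ h unique
    ... | yes Px | no ¬Qx with x ≟ w
    ...   | no x≢w   = contradiction (h x≢w Px) ¬Qx
    -- By uniqueness `w` does not recur in the tail, so `P` implies `Q` there.
    ...   | yes refl = +ᴿ-mono-≤ (π x) (π x) (sP xs) (sQ xs) (≤ᴿ-refl (π x))
                         (sumOver-mono (All.map (h ∘ ≢-sym) x≢xs))

    sumOver-with : ∀ {v} → ¬ P v → Q v → (∀ {x} → P x → Q x) →
                   ∀ {xs} → v ∈ xs → π v +ᴿ sP xs ≤ᴿ sQ xs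
    sumOver-with {v} ¬Pv Qv P⊆Q {_ ∷ xs} (here refl) with P? v | Q? v
    ... | yes Pv | _      = contradiction Pv ¬Pv
    ... | no _   | no ¬Qv = contradiction Qv ¬Qv
    ... | no _   | yes _  = +ᴿ-mono-≤ (π v) (π v) (sP xs) (sQ xs) (≤ᴿ-refl (π v))
                              (sumOver-mono (All.universal (λ _ → P⊆Q) xs))
    sumOver-with {v} ¬Pv Qv P⊆Q {x ∷ xs} (there v∈xs) with P? x | Q? x
    ... | yes Px | yes _  = ≤ᴿ-trans (π v +ᴿ (π x +ᴿ sP xs)) (π x +ᴿ (π v +ᴿ sP xs)) (π x +ᴿ sQ xs)
                              (+ᴿ-leftSwap (π v) (π x) (sP xs))
                              (+ᴿ-mono-≤ (π x) (π x) (π v +ᴿ sP xs) (sQ xs) (≤ᴿ-refl (π x))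
                                (sumOver-with ¬Pv Qv P⊆Q v∈xs))
    ... | yes Px | no ¬Qx = contradiction (P⊆Q Px) ¬Qx
    ... | no _   | yes _  = ≤ᴿ-trans (π v +ᴿ sP xs) (sQ xs) (π x +ᴿ sQ xs)
                              (sumOver-with ¬Pv Qv P⊆Q v∈xs) (y≤ᴿx+y (π x) (sQ xs) (π≥0 x))
    ... | no _   | no _   = sumOver-with ¬Pv Qv P⊆Q v∈xs

  -- `no id` decides the empty predicate. Comparison with its sum turns `sumOver-with` and
  -- `sumOver-without` into the two one-term bounds that follow.
  sumOver-none : ∀ xs → sumOver (λ _ → no id) xs ≡ 0ᴿ
  sumOver-none xs = cong (sumᴿ ∘ List.map π) (filter-none (λ _ → no id) (All.universal (λ _ ()) xs))

  term≤sumOver : {P : Pred A 0ℓ} (P? : U.Decidable P) →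
                 ∀ {v xs} → P v → v ∈ xs → π v ≤ᴿ sumOver P? xs
  term≤sumOver P? {v} {xs} Pv v∈xs =
    ≤ᴿ-trans (π v) (π v +ᴿ sumOver (λ _ → no id) xs) (sumOver P? xs)
      (x≤ᴿx+y (π v) (sumOver (λ _ → no id) xs) (subst (0ᴿ ≤ᴿ_) (sym (sumOver-none xs)) (≤ᴿ-refl 0ᴿ)))
      (sumOver-with (λ _ → no id) P? id Pv (λ ()) v∈xs)

  sumOver≤term : DecidableEquality A → {P : Pred A 0ℓ} (P? : U.Decidable P) →
                 ∀ {w xs} → (∀ {x} → P x → x ≡ w) → Unique xs → sumOver P? xs ≤ᴿ π w
  sumOver≤term _≟_ P? {w} {xs} P⇒≡w unique =
    ≤ᴿ-trans (sumOver P? xs) (π w +ᴿ 0ᴿ) (π w)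
      (subst (λ z → sumOver P? xs ≤ᴿ π w +ᴿ z) (sumOver-none xs)
        (sumOver-without P? (λ _ → no id) _≟_ (λ x≢w Px → x≢w (P⇒≡w Px)) unique))
      (x+0≤ᴿx (π w))

  -- Passes through `rest`, the sum over `P` without `w`: the left sum is at most `π w +ᴿ rest`, and
  -- the right sum is at least `π v +ᴿ rest`.
  sumOver-exchange : DecidableEquality A →
                     {P Q : Pred A 0ℓ} (P? : U.Decidable P) (Q? : U.Decidable Q) →
                     ∀ {v w xs} → π w ≤ᴿ π v → ¬ P v → Q v → (∀ {x} → x ≢ w → P x → Q x) →
                     v ∈ xs → Unique xs → sumOver P? xs ≤ᴿ sumOver Q? xs
  sumOver-exchange _≟_ P? Q? {v} {w} {xs} πw≤πv ¬Pv Qv h v∈xs unique =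
    ≤ᴿ-trans (sumOver P? xs) (π w +ᴿ rest) (sumOver Q? xs)
      (sumOver-without P? rest? _≟_ (λ x≢w Px → Px , x≢w) unique)
      (≤ᴿ-trans (π w +ᴿ rest) (π v +ᴿ rest) (sumOver Q? xs)
        (+ᴿ-mono-≤ (π w) (π v) rest rest πw≤πv (≤ᴿ-refl rest))
        (sumOver-with rest? Q? (¬Pv ∘ proj₁) Qv (λ (Px , x≢w) → h x≢w Px) v∈xs))
    where
    rest? = λ x → P? x ×-dec ¬? (x ≟ w)
    rest  = sumOver rest? xs

-- Distances and territories

-- This covers a `k` beyond the search range too, since the search never returns more than `b`.
leastUpTo-≤ : {P : ℕ → Set} (P? : ∀ k → Dec (P k)) → ∀ b {k} → P k → leastUpTo P? b ≤ k
leastUpTo-≤ P? zero    Pk = z≤n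
leastUpTo-≤ P? (suc b) {k} Pk with P? zero | k
... | yes _  | _     = z≤n
... | no ¬P0 | zero  = contradiction Pk ¬P0
... | no ¬P0 | suc k = s≤s (leastUpTo-≤ (P? ∘ suc) b Pk)

leastUpTo-satisfies : {P : ℕ → Set} (P? : ∀ k → Dec (P k)) → ∀ b → P b → P (leastUpTo P? b)
leastUpTo-satisfies P? zero    Pb = Pb
leastUpTo-satisfies P? (suc b) Pb with P? zero
... | yes P0 = P0
... | no _   = leastUpTo-satisfies (P? ∘ suc) b Pb

foldr₁-⊓-lower : ∀ {p} (xs : Vec ℕ (suc p)) i → foldr₁ _⊓_ xs ≤ lookup xs i
foldr₁-⊓-lower (x ∷ [])     zero    = ℕₚ.≤-refl
foldr₁-⊓-lower (x ∷ y ∷ ys) zero    = ℕₚ.m⊓n≤m x _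
foldr₁-⊓-lower (x ∷ y ∷ ys) (suc i) =
  ℕₚ.≤-trans (ℕₚ.m⊓n≤n x _) (foldr₁-⊓-lower (y ∷ ys) i)

-- Choosing the head whenever it ties with the minimum of the tail gives the leftmost minimum. This
-- is the tie-breaking of prioritized Voronoi diagrams, so the territories cover all vertices.
foldr₁-⊓-first : ∀ {p} (xs : Vec ℕ (suc p)) → ∃ λ i →
                 lookup xs i ≡ foldr₁ _⊓_ xs × (∀ j → j Fin.< i → foldr₁ _⊓_ xs < lookup xs j)
foldr₁-⊓-first (x ∷ [])     = zero , refl , λ _ ()
foldr₁-⊓-first (x ∷ y ∷ ys) with ℕₚ.≤-<-connex x (foldr₁ _⊓_ (y ∷ ys))
... | inj₁ x≤m = zero , sym (ℕₚ.m≤n⇒m⊓n≡m x≤m) , λ _ ()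
... | inj₂ m<x =
  let i , eq , before = foldr₁-⊓-first (y ∷ ys)
      m≡              = ℕₚ.m≥n⇒m⊓n≡n (ℕₚ.<⇒≤ m<x)
  in suc i , trans eq (sym m≡) , λ where
       zero    _         → subst (_< x) (sym m≡) m<x
       (suc j) (s≤s j<i) → subst (_< lookup (y ∷ ys) j) (sym m≡) (before j j<i)

lookup-∷ʳ-fromℕ : ∀ {A : Set} {p} (S : Vec A p) v → lookup (S ∷ʳ v) (Fin.fromℕ p) ≡ v
lookup-∷ʳ-fromℕ []      v = refl
lookup-∷ʳ-fromℕ (x ∷ S) v = lookup-∷ʳ-fromℕ S v

lookup-∷ʳ-≡⊎∈ : ∀ {A : Set} {p} (S : Vec A p) v i →
                 lookup (S ∷ʳ v) i ≡ v ⊎ lookup (S ∷ʳ v) i ∈ᵛ S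
lookup-∷ʳ-≡⊎∈ []      v zero    = inj₁ refl
lookup-∷ʳ-≡⊎∈ (x ∷ S) v zero    = inj₂ (here refl)
lookup-∷ʳ-≡⊎∈ (x ∷ S) v (suc i) = Sum.map₂ there (lookup-∷ʳ-≡⊎∈ S v i)

lookup-∷ʳ-≡⊎≡ : ∀ {A : Set} {p} (S : Vec A p) v w i →
                 lookup (S ∷ʳ w) i ≡ w ⊎ lookup (S ∷ʳ w) i ≡ lookup (S ∷ʳ v) i
lookup-∷ʳ-≡⊎≡ []      v w zero    = inj₁ refl
lookup-∷ʳ-≡⊎≡ (x ∷ S) v w zero    = inj₂ refl
lookup-∷ʳ-≡⊎≡ (x ∷ S) v w (suc i) = lookup-∷ʳ-≡⊎≡ S v w i

module _ {n : ℕ} (G : Graph n) where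

  walk⇒dist≤ : ∀ {u v} k → Walk (Adj G) k u v → dist G u v ≤ k
  walk⇒dist≤ {u} {v} k =
    leastUpTo-≤ (λ k → walk? (Adj G) (adj? G) k u v) (proj₁ (connected G u v))

  dist-self : ∀ v → dist G v v ≡ 0
  dist-self v = ℕₚ.n≤0⇒n≡0 (walk⇒dist≤ 0 refl)

  dist≡0⇒≡ : ∀ {u v} → dist G u v ≡ 0 → u ≡ v
  dist≡0⇒≡ {u} {v} eq = subst (λ k → Walk (Adj G) k u v) eq
    (leastUpTo-satisfies (λ k → walk? (Adj G) (adj? G) k u v) _ (proj₂ (connected G u v)))

  ≢⇒dist≥1 : ∀ {u v} → u ≢ v → 1 ≤ dist G u v
  ≢⇒dist≥1 u≢v = ℕₚ.n≢0⇒n>0 (u≢v ∘ dist≡0⇒≡)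

  distToSites-lower : ∀ {p} (T : Vec (Fin n) (suc p)) u i → distToSites G u T ≤ dist G u (lookup T i)
  distToSites-lower T u i =
    subst (distToSites G u T ≤_) (lookup-map i (dist G u) T) (foldr₁-⊓-lower (Vec.map (dist G u) T) i)

  inSomeTerritory : ∀ {p} (T : Vec (Fin n) (suc p)) u → ∃ λ i → InTerritory G T i u
  inSomeTerritory T u =
    let i , eq , before = foldr₁-⊓-first (Vec.map (dist G u) T)
    in i , trans (sym (lookup-map i (dist G u) T)) eq ,
       λ j j<i → subst (distToSites G u T <_) (lookup-map j (dist G u) T) (before j j<i)

  -- No index precedes `zero`, so the priority condition is vacuous and the first site wins every
  -- tie.
  inFirstTerritory : ∀ {p} (T : Vec (Fin n) (suc p)) u →
                     (∀ i → dist G u (lookup T zero) ≤ dist G u (lookup T i)) →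
                     InTerritory G T zero u
  inFirstTerritory T u nearest =
    let i , eq , _ = inSomeTerritory T u
    in ℕₚ.≤-antisym (ℕₚ.≤-trans (nearest i) (ℕₚ.≤-reflexive eq)) (distToSites-lower T u zero) , λ _ ()

  firstTerritory-nearest : ∀ {p} (T : Vec (Fin n) (suc p)) {u} → InTerritory G T zero u →
                           ∀ i → dist G u (lookup T zero) ≤ dist G u (lookup T i)
  firstTerritory-nearest T {u} (eq , _) i = ℕₚ.≤-trans (ℕₚ.≤-reflexive eq) (distToSites-lower T u i)

  -- Bounds on loads, in general and in cliques

  module _ (π : Fin n → ℝ) (π≥0 : ∀ v → 0ᴿ ≤ᴿ π v) where

    cost≤maxLoad : ∀ {p} (T : Vec (Fin n) (suc p)) v → π v ≤ᴿ maxLoad G π T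
    cost≤maxLoad T v =
      let i , v∈i = inSomeTerritory T v
      in ≤ᴿ-trans (π v) (load G π T i) (maxLoad G π T)
           (term≤sumOver π π≥0 (inTerritory? G T i) v∈i (∈-allFin v))
           (foldr₁-⊔ᴿ-upper (load G π T) i)

    module _ (clique : IsClique G) where

      clique-dist≤1 : ∀ u v → dist G u v ≤ 1
      clique-dist≤1 u v with u Finₚ.≟ v
      ... | yes refl = subst (_≤ 1) (sym (dist-self u)) z≤n
      ... | no u≢v   = walk⇒dist≤ 1 (v , clique u≢v , refl)

      -- A later owner must be strictly closer than the first site, whose distance is at most 1; so
      -- its distance is 0.
      clique-laterTerritory : ∀ {p} (T : Vec (Fin n) (suc (suc p))) i {u} →
                              InTerritory G T (suc i) u → u ≡ lookup T (suc i)
      clique-laterTerritory T i {u} (eq , before) = dist≡0⇒≡ (trans eq (ℕₚ.n<1⇒n≡0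
        (ℕₚ.<-≤-trans (before zero (s≤s z≤n)) (clique-dist≤1 u _))))

      clique-maxLoad-antitone : ∀ {p} (S : Vec (Fin n) p) {v w} → v ∉ S → v ≢ w → π w ≤ᴿ π v →
                                maxLoad G π (S ∷ʳ v) ≤ᴿ maxLoad G π (S ∷ʳ w)
      clique-maxLoad-antitone [] {v} {w} _ _ _ =
        sumOver-mono π π≥0 (inTerritory? G (v ∷ []) zero) (inTerritory? G (w ∷ []) zero)
          -- The minimum over a single site is its own distance, so that site owns every vertex.
          (All.universal (λ _ _ → refl , λ _ ()) (allFin n))
      clique-maxLoad-antitone (s ∷ S) {v} {w} v∉S v≢w πw≤πv =
        foldr₁-⊔ᴿ-least (load G π Tv) (maxLoad G π Tw) λ where
          zero    → ≤ᴿ-trans (load G π Tv zero) (load G π Tw zero) (maxLoad G π Tw)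
                      firstLoad≤ (foldr₁-⊔ᴿ-upper (load G π Tw) zero)
          -- Old sites and `v` are treated alike: such a site owns at most itself, and its cost is
          -- counted in the load of whichever site owns it under `Tw`.
          (suc i) → ≤ᴿ-trans (load G π Tv (suc i)) (π (lookup Tv (suc i))) (maxLoad G π Tw)
                      (sumOver≤term π π≥0 Finₚ._≟_ (inTerritory? G Tv (suc i))
                        (clique-laterTerritory Tv i) (allFin⁺ n))
                      (cost≤maxLoad Tw (lookup Tv (suc i)))
        where
        Tv Tw : Vec (Fin n) _
        Tv = (s ∷ S) ∷ʳ v
        Tw = (s ∷ S) ∷ʳ w

        v-leaves : ¬ InTerritory G Tv zero v
        -- `Fin.fromℕ _` is the position of `v` in `Tv`. Its distance from `v` is 0, so staying with
        -- `s` would force `v` to equal `s`.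
        v-leaves v∈ = v∉S (here (dist≡0⇒≡ (ℕₚ.n≤0⇒n≡0 (ℕₚ.≤-trans
          (firstTerritory-nearest Tv v∈ (Fin.fromℕ _))
          (ℕₚ.≤-reflexive (trans (cong (dist G v) (lookup-∷ʳ-fromℕ (s ∷ S) v)) (dist-self v)))))))

        v≢site : ∀ i → v ≢ lookup Tw i
        v≢site i v≡ with lookup-∷ʳ-≡⊎∈ (s ∷ S) w i
        ... | inj₁ ≡w = v≢w (trans v≡ ≡w)
        ... | inj₂ ∈S = v∉S (subst (_∈ᵛ (s ∷ S)) (sym v≡) ∈S)

        v-enters : InTerritory G Tw zero v
        -- All sites of `Tw` are at distance at least 1 from `v` and `s` at most 1, so `s` wins the
        -- tie.
        v-enters = inFirstTerritory Tw v λ i →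
          ℕₚ.≤-trans (clique-dist≤1 v s) (≢⇒dist≥1 (v≢site i))

        others-stay : ∀ {u} → u ≢ w → InTerritory G Tv zero u → InTerritory G Tw zero u
        others-stay {u} u≢w u∈ = inFirstTerritory Tw u nearest
          where
          nearest : ∀ i → dist G u s ≤ dist G u (lookup Tw i)
          -- Only the last site differs between `Tv` and `Tw`, and the new one, `w`, is no closer to
          -- `u` than `s`.
          nearest i with lookup-∷ʳ-≡⊎≡ (s ∷ S) v w i
          ... | inj₁ ≡w = ℕₚ.≤-trans (clique-dist≤1 u s)
                            (≢⇒dist≥1 (λ u≡ → u≢w (trans u≡ ≡w)))
          ... | inj₂ eq = subst (λ x → dist G u s ≤ dist G u x) (sym eq)
                            (firstTerritory-nearest Tv u∈ i)

        firstLoad≤ : load G π Tv zero ≤ᴿ load G π Tw zero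
        firstLoad≤ = sumOver-exchange π π≥0 Finₚ._≟_ (inTerritory? G Tv zero) (inTerritory? G Tw zero)
          πw≤πv v-leaves v-enters others-stay (∈-allFin v) (allFin⁺ n)

clique-balanced : ∀ {n p} (I : Instance n p) → IsClique (graph I) → ∀ {v} → v ∉ sites I →
                  (∀ w → w ∉ sites I → cost I w ≤ᴿ cost I v) → IsBalancedVertex I v
clique-balanced I clique {v} v∉S maximal = v∉S , optimal
  where
  optimal : ∀ w → w ∉ sites I →
            maxLoad (graph I) (cost I) (sites I ∷ʳ v) ≤ᴿ maxLoad (graph I) (cost I) (sites I ∷ʳ w)
  optimal w w∉S with v Finₚ.≟ w
  ... | yes refl = ≤ᴿ-refl (maxLoad (graph I) (cost I) (sites I ∷ʳ v))
  ... | no v≢w   = clique-maxLoad-antitone (graph I) (cost I) (cost≥0 I) clique (sites I)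
                     v∉S v≢w (maximal w w∉S)
-- The program

-- Registers for naturals; the input fills the first two.
vertexCount siteCount siteIndex one two temp vertex best : ℕ
vertexCount = 0
siteCount   = 1
siteIndex   = 2
one         = 3
two         = 4
temp        = 5
vertex      = 6
best        = 7

bestCost vertexCost : ℕ
bestCost   = 0
vertexCost = 1

-- Sites are marked by 2 in the first row of the adjacency matrix, at address
-- p; that row has n entries, all of them at most 1 in the input.
scanMaxNonSite : Program
scanMaxNonSite =
    const one 1
  ∷ const two 2
    -- 2: mark the sites
  ∷ jump≤ siteCount siteIndex 8
  ∷ loadN temp siteIndex
  ∷ add temp siteCount temp
  ∷ storeN temp two
  ∷ add siteIndex siteIndex one
  ∷ jump 2
    -- 8: scan the vertices
  ∷ jump≤ vertexCount vertex 19
  ∷ add temp siteCount vertex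
  ∷ loadN temp temp
  ∷ jump≤ two temp 17
  ∷ loadR vertexCost vertex
  ∷ jump≤R bestCost vertexCost 15
  ∷ jump 17
    -- 15: new best vertex
  ∷ moveR bestCost vertexCost
  ∷ move best vertex
    -- 17: next vertex
  ∷ add vertex vertex one
  ∷ jump 8
    -- 19: output
  ∷ move 0 best
  ∷ []

-- Memory updates and the layout of the input

[≔]-same : ∀ {ℓ} {A : Set ℓ} (f : ℕ → A) i x → (f [ i ≔ x ]) i ≡ x
[≔]-same f i x rewrite dec-true (i ℕₚ.≟ i) refl = refl

[≔]-other : ∀ {ℓ} {A : Set ℓ} (f : ℕ → A) {i j} x → j ≢ i → (f [ i ≔ x ]) j ≡ f j
[≔]-other f {i} {j} x j≢i rewrite dec-false (j ℕₚ.≟ i) j≢i = refl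

nth-All : ∀ {A : Set} {P : Pred A 0ℓ} {d xs} → P d → All P xs → ∀ i → P (nth d xs i)
nth-All Pd []         i       = Pd
nth-All Pd (px ∷ pxs) zero    = px
nth-All Pd (px ∷ pxs) (suc i) = nth-All Pd pxs i

nth-map-tabulate : ∀ {ℓ} {A : Set ℓ} {B : Set} (d : A) {n} (f : B → A) (g : Fin n → B) i →
                   nth d (List.map f (List.tabulate g)) (toℕ i) ≡ f (g i)
nth-map-tabulate d f g zero    = refl
nth-map-tabulate d f g (suc i) = nth-map-tabulate d f (g ∘ suc) i

nth-site : ∀ {n p} (S : Vec (Fin n) p) ys j →
           nth 0 (List.map toℕ (toList S) ++ ys) (toℕ j) ≡ toℕ (lookup S j)
nth-site (s ∷ S) ys zero    = refl
nth-site (s ∷ S) ys (suc j) = nth-site S ys j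

nth-afterSites : ∀ {n p} (S : Vec (Fin n) p) ys k →
                 nth 0 (List.map toℕ (toList S) ++ ys) (p + k) ≡ nth 0 ys k
nth-afterSites []      ys k = refl
nth-afterSites (s ∷ S) ys k = nth-afterSites S ys k

-- The invariant of the marking loop

module _ {n p : ℕ} (S : Vec (Fin n) p) where

  -- Describes memory after `i` sites are processed. The bounds 2 and below 2 are all that the test
  -- `jump≤ two temp` observes.
  record Marking (i : ℕ) (M : ℕ → ℕ) : Set where
    field
      sites-stored : ∀ j → M (toℕ j) ≡ toℕ (lookup S j)
      marked       : ∀ j → toℕ j < i → 2 ≤ M (p + toℕ (lookup S j))
      unmarked     : ∀ v → v ∉ S → M (p + toℕ v) < 2

  open Marking

  -- The write goes to an address at least `p`, so the stored sites survive; it hits the cell of a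
  -- site, so the cells of non-sites survive. The equations on `a` and `x` admit register contents
  -- known only propositionally.
  Marking-step : ∀ {i M a x} j → toℕ j ≡ i → a ≡ p + toℕ (lookup S j) → x ≡ 2 →
                 Marking i M → Marking (suc i) (M [ a ≔ x ])
  Marking-step {M = M} j refl refl refl inv = record
    { sites-stored = λ j′ → trans
        ([≔]-other M 2 (ℕₚ.<⇒≢ (ℕₚ.<-≤-trans (Finₚ.toℕ<n j′) (ℕₚ.m≤m+n p _))))
        (sites-stored inv j′)
    ; marked       = marked′
    ; unmarked     = λ v v∉S → subst (_< 2)
        (sym ([≔]-other M 2 (λ eq → v∉S (subst (_∈ᵛ S)
          (sym (Finₚ.toℕ-injective (ℕₚ.+-cancelˡ-≡ p _ _ eq))) (∈-lookup j S)))))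
        (unmarked inv v v∉S)
    }
    where
    site = λ j → p + toℕ (lookup S j)

    marked′ : ∀ j′ → toℕ j′ < suc (toℕ j) → 2 ≤ (M [ site j ≔ 2 ]) (site j′)
    marked′ j′ j′<1+j with site j′ ℕₚ.≟ site j
    ... | yes eq = subst (λ a → 2 ≤ (M [ site j ≔ 2 ]) a) (sym eq)
                     (ℕₚ.≤-reflexive (sym ([≔]-same M (site j) 2)))
    ... | no neq with ℕₚ.m<1+n⇒m<n∨m≡n j′<1+j
    ...   | inj₁ j′<j = subst (2 ≤_) (sym ([≔]-other M 2 neq)) (marked inv j′ j′<j)
    ...   | inj₂ j′≡j = contradiction (cong site (Finₚ.toℕ-injective j′≡j)) neq

  Marking-complete : ∀ {M} → Marking p M → ∀ v → v ∈ᵛ S → 2 ≤ M (p + toℕ v)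
  Marking-complete {M} inv v v∈S =
    subst (λ u → 2 ≤ M (p + toℕ u)) (sym (Anyᵛₚ.lookup-index v∈S))
      (marked inv (Anyᵛ.index v∈S) (Finₚ.toℕ<n (Anyᵛ.index v∈S)))

-- Correctness and running time of the program

module Correctness (em : ExcludedMiddle 0ℓ) {n p : ℕ} (I : Instance n p)
                   (clique : IsClique (graph I)) where

  open Execution (λ x y → em {x ≤ᴿ y})
  open DecMembership (Finₚ._≟_ {n}) using (_∈?_)
  open Marking

  -- Speaks of the whole remaining run and its final answer, so the proof composes backwards: each
  -- instruction is put in front of the run that follows it.
  SolvesFrom : ℕ → State → Set₁
  SolvesFrom T σ = ∃ λ t → ∃ λ τ → scanMaxNonSite ⊢ σ ⇓[ t ] τ × t ≤ T ×
    (∃ λ v → regN τ 0 ≡ toℕ v × IsBalancedVertex I v)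

  weaken : ∀ {T T′ σ} → T ≤ T′ → SolvesFrom T σ → SolvesFrom T′ σ
  weaken T≤T′ (t , τ , run , t≤T , post) = t , τ , run , ℕₚ.≤-trans t≤T T≤T′ , post

  tick : ∀ {T σ σ′} → step scanMaxNonSite σ ≡ just σ′ → SolvesFrom T σ′ → SolvesFrom (suc T) σ
  tick eq (t , τ , run , t≤T , post) = suc t , τ , next eq run , s≤s t≤T , post

  module _ {T : ℕ} {σ : State} {c t : ℕ} {N : ℕ → ℕ} {R : ℕ → ℝ} {M : ℕ → ℕ} {Q : ℕ → ℝ}
           {A : Set} (a? : Dec A)
           (eq : step scanMaxNonSite σ ≡ just (state (if does a? then t else c) N R M Q)) where

    -- `eq` leaves the branch undecided, so `refl` proves it at each use; the proof of `A` then
    -- selects the jump target.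
    tick-then : A → SolvesFrom T (state t N R M Q) → SolvesFrom (suc T) σ
    tick-then a = tick
      (trans eq (cong (λ b → just (state (if b then t else c) N R M Q)) (dec-true a? a)))

    tick-else : ¬ A → SolvesFrom T (state c N R M Q) → SolvesFrom (suc T) σ
    tick-else ¬a = tick
      (trans eq (cong (λ b → just (state (if b then t else c) N R M Q)) (dec-false a? ¬a)))

  Constants : (ℕ → ℕ) → Set
  Constants N = N vertexCount ≡ n × N siteCount ≡ p × N one ≡ 1 × N two ≡ 2

  costs : ℕ → ℝ
  costs = memR (initial I)

  costs-toℕ : ∀ v → costs (toℕ v) ≡ cost I v
  costs-toℕ = nth-map-tabulate 0ᴿ (cost I) id

  -- Vertices below `u` have been scanned. The second alternative of `found` is the state before any
  -- non-site is met: with `bestCost` at most zero, the first non-site passes the comparison even if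
  -- its cost is zero.
  record Scanned (u : ℕ) (N : ℕ → ℕ) (R : ℕ → ℝ) : Set₁ where
    field
      constants : Constants N
      position  : N vertex ≡ u
      dominates : ∀ w → w ∉ sites I → toℕ w < u → cost I w ≤ᴿ R bestCost
      found     : (∃ λ b → N best ≡ toℕ b × b ∉ sites I × R bestCost ≤ᴿ cost I b) ⊎
                  (R bestCost ≤ᴿ 0ᴿ × (∀ w → w ∉ sites I → u ≤ toℕ w))

  output : ∀ {N R M} → Scanned n N R → SolvesFrom 2 (state 19 N R M costs)
  output {N} {R} inv with Scanned.found inv
  ... | inj₁ (b , best≡ , b∉S , R≤b) =
    -- The two steps are the final `move` and halting by leaving the program.
    tick refl (1 , _ , done refl , ℕₚ.≤-refl , b , best≡ , clique-balanced I clique b∉S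
      (λ w w∉S → ≤ᴿ-trans (cost I w) (R bestCost) (cost I b)
        (Scanned.dominates inv w w∉S (Finₚ.toℕ<n w)) R≤b))
  ... | inj₂ (_ , none) =
    let w , w∉S = hasNonSite I
    in contradiction (Finₚ.toℕ<n w) (ℕₚ.≤⇒≯ (none w w∉S))

  module _ {N : ℕ → ℕ} {R : ℕ → ℝ} (v : Fin n) (inv : Scanned (toℕ v) N R) where
    open Scanned inv

    private
      extend : ∀ {x} → (v ∉ sites I → cost I v ≤ᴿ x) → R bestCost ≤ᴿ x →
               ∀ w → w ∉ sites I → toℕ w < suc (toℕ v) → cost I w ≤ᴿ x
      extend {x} v≤x R≤x w w∉S w<1+v with ℕₚ.m<1+n⇒m<n∨m≡n w<1+v
      ... | inj₁ w<v = ≤ᴿ-trans (cost I w) (R bestCost) x (dominates w w∉S w<v) R≤x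
      ... | inj₂ w≡v with refl ← Finₚ.toℕ-injective w≡v = v≤x w∉S

    Scanned-skip : ∀ {N′ R′} → Constants N′ → N′ vertex ≡ suc (toℕ v) → N′ best ≡ N best →
                   R′ bestCost ≡ R bestCost → (v ∉ sites I → cost I v ≤ᴿ R bestCost) →
                   v ∈ᵛ sites I ⊎ ¬ R bestCost ≤ᴿ cost I v → Scanned (suc (toℕ v)) N′ R′
    Scanned-skip {N′} {R′} constants′ position′ best≡ R≡ v≤R skip = record
      { constants = constants′
      ; position  = position′
      ; dominates = subst (λ x → ∀ w → w ∉ sites I → toℕ w < suc (toℕ v) → cost I w ≤ᴿ x)
          (sym R≡) (extend {R bestCost} v≤R (≤ᴿ-refl (R bestCost)))
      ; found     = found′ found skip
      }
      where
      found′ : (∃ λ b → N best ≡ toℕ b × b ∉ sites I × R bestCost ≤ᴿ cost I b) ⊎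
               (R bestCost ≤ᴿ 0ᴿ × (∀ w → w ∉ sites I → toℕ v ≤ toℕ w)) →
               v ∈ᵛ sites I ⊎ ¬ R bestCost ≤ᴿ cost I v →
               (∃ λ b → N′ best ≡ toℕ b × b ∉ sites I × R′ bestCost ≤ᴿ cost I b) ⊎
               (R′ bestCost ≤ᴿ 0ᴿ × (∀ w → w ∉ sites I → suc (toℕ v) ≤ toℕ w))
      found′ (inj₁ (b , b≡ , b∉S , R≤b)) _ =
        inj₁ (b , trans best≡ b≡ , b∉S , subst (_≤ᴿ cost I b) (sym R≡) R≤b)
      found′ (inj₂ (R≤0 , none)) (inj₁ v∈S) =
        inj₂ (subst (_≤ᴿ 0ᴿ) (sym R≡) R≤0 , λ w w∉S → ℕₚ.≤∧≢⇒< (none w w∉S)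
          (λ v≡w → w∉S (subst (_∈ᵛ sites I) (Finₚ.toℕ-injective v≡w) v∈S)))
      -- The first non-site cannot fail the comparison, since `R bestCost` is at most zero and costs
      -- are nonnegative.
      found′ (inj₂ (R≤0 , none)) (inj₂ R≰v) =
        contradiction (≤ᴿ-trans (R bestCost) 0ᴿ (cost I v) R≤0 (cost≥0 I v)) R≰v

    Scanned-update : ∀ {N′ R′} → Constants N′ → N′ vertex ≡ suc (toℕ v) → N′ best ≡ toℕ v →
                     R′ bestCost ≡ cost I v → v ∉ sites I → R bestCost ≤ᴿ cost I v →
                     Scanned (suc (toℕ v)) N′ R′
    Scanned-update constants′ position′ best≡ R≡ v∉S R≤v = record
      { constants = constants′
      ; position  = position′
      ; dominates = subst (λ x → ∀ w → w ∉ sites I → toℕ w < suc (toℕ v) → cost I w ≤ᴿ x)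
          (sym R≡) (extend {cost I v} (λ _ → ≤ᴿ-refl (cost I v)) R≤v)
      ; found     = inj₁ (v , best≡ , v∉S , subst (_≤ᴿ cost I v) (sym R≡) (≤ᴿ-refl (cost I v)))
      }

  -- A pass that updates the best vertex, the longest kind, takes 10 instructions. The 3 are the
  -- exit jump and the two steps of `output`.
  scanTime : ℕ → ℕ
  scanTime k = k * 10 + 3

  scan : ∀ k {u N R M} → Marking (sites I) p M → Scanned u N R → u + k ≡ n →
         SolvesFrom (scanTime k) (state 8 N R M costs)

  visit : ∀ k {N R M} v → Marking (sites I) p M → Scanned (toℕ v) N R → suc (toℕ v) + k ≡ n →
          SolvesFrom (scanTime (suc k)) (state 8 N R M costs)

  scan zero {u} {N} {R} {M} marking inv u≡n
    with refl ← trans (sym (ℕₚ.+-identityʳ u)) u≡n =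
    tick-then (N vertexCount ℕₚ.≤? N vertex) refl
      (ℕₚ.≤-reflexive (trans (proj₁ (Scanned.constants inv)) (sym (Scanned.position inv))))
      (output inv)
  scan (suc k) {u} {N} {R} marking inv u+1+k≡n =
    visit k (fromℕ< u<n) marking (subst (λ u → Scanned u N R) (sym v≡u) inv)
      (trans (cong (λ u → suc u + k) v≡u) 1+u+k≡n)
    where
    1+u+k≡n : suc u + k ≡ n
    1+u+k≡n = trans (sym (ℕₚ.+-suc u k)) u+1+k≡n

    u<n : u < n
    u<n = ℕₚ.m+n≤o⇒m≤o (suc u) (ℕₚ.≤-reflexive 1+u+k≡n)

    v≡u : toℕ (fromℕ< u<n) ≡ u
    v≡u = Finₚ.toℕ-fromℕ< u<n

  visit k {N} {R} {M} v marking inv 1+v+k≡n =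
    tick-else (N vertexCount ℕₚ.≤? N vertex) refl
      (λ n≤v → ℕₚ.<⇒≱ (Finₚ.toℕ<n v)
        (subst (_≤ toℕ v) (proj₁ constants) (subst (N vertexCount ≤_) position n≤v)))
      (tick refl (tick refl (test (v ∈? sites I))))
    where
    open Scanned inv

    flag : ℕ
    flag = M (N siteCount + N vertex)

    flag≡ : flag ≡ M (p + toℕ v)
    flag≡ = cong M (cong₂ _+_ (proj₁ (proj₂ constants)) position)

    two≡ : N two ≡ 2
    two≡ = proj₂ (proj₂ (proj₂ constants))

    vertexCost≡ : costs (N vertex) ≡ cost I v
    vertexCost≡ = trans (cong costs position) (costs-toℕ v)

    vertex+1≡ : N vertex + N one ≡ suc (toℕ v)
    vertex+1≡ = trans (cong₂ _+_ position (proj₁ (proj₂ (proj₂ constants)))) (ℕₚ.+-comm (toℕ v) 1)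

    N₁ : ℕ → ℕ
    N₁ = (N [ temp ≔ N siteCount + N vertex ]) [ temp ≔ flag ]

    R₁ : ℕ → ℝ
    R₁ = R [ vertexCost ≔ costs (N vertex) ]

    compare : v ∉ sites I → Dec (R bestCost ≤ᴿ costs (N vertex)) →
              SolvesFrom (5 + scanTime k) (state 13 N₁ R₁ M costs)
    compare v∉S (yes R≤v) =
      tick-then (em {R bestCost ≤ᴿ costs (N vertex)}) refl R≤v
        (tick refl (tick refl (tick refl (tick refl
          (scan k marking
            (Scanned-update v inv constants vertex+1≡ position vertexCost≡ v∉S
              (subst (R bestCost ≤ᴿ_) vertexCost≡ R≤v))
            1+v+k≡n)))))
    compare v∉S (no R≰v) =
      -- Rejection takes 4 instructions from here, one fewer than an update.
      weaken (ℕₚ.n≤1+n _)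
        (tick-else (em {R bestCost ≤ᴿ costs (N vertex)}) refl R≰v
          (tick refl (tick refl (tick refl
            (scan k marking
              (Scanned-skip v inv constants vertex+1≡ refl refl
                (λ _ → ≰ᴿ⇒≥ᴿ em (R bestCost) (cost I v) R≰cost) (inj₂ R≰cost))
              1+v+k≡n)))))
      where
      R≰cost : ¬ R bestCost ≤ᴿ cost I v
      R≰cost = R≰v ∘ subst (R bestCost ≤ᴿ_) (sym vertexCost≡)

    test : Dec (v ∈ᵛ sites I) → SolvesFrom (7 + scanTime k) (state 11 N₁ R M costs)
    test (yes v∈S) =
      -- A site uses only 3 of the 7 instructions allowed.
      weaken (ℕₚ.m≤n+m _ 4)
        (tick-then (N two ℕₚ.≤? flag) refl
          (subst (_≤ flag) (sym two≡)
            (subst (2 ≤_) (sym flag≡) (Marking-complete (sites I) marking v v∈S)))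
          (tick refl (tick refl
            (scan k marking
              (Scanned-skip v inv constants vertex+1≡ refl refl
                (λ v∉S → contradiction v∈S v∉S) (inj₁ v∈S))
              1+v+k≡n))))
    test (no v∉S) =
      tick-else (N two ℕₚ.≤? flag) refl
        (λ 2≤flag → ℕₚ.<⇒≱ (unmarked marking v v∉S) (subst (_≤ M (p + toℕ v)) two≡
          (subst (N two ≤_) flag≡ 2≤flag)))
        (tick refl (compare v∉S em))

  -- Each site costs one pass of 6 instructions; the 1 is the exit jump.
  markTime : ℕ → ℕ
  markTime k = k * 6 + (1 + scanTime n)

  mark : ∀ k {i N M} → Constants N → N siteIndex ≡ i → N vertex ≡ 0 →
         Marking (sites I) i M → i + k ≡ p →
         SolvesFrom (markTime k) (state 2 N (λ _ → 0ᴿ) M costs)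
  mark zero {i} {N} constants index≡ vertex≡ marking i≡p
    with refl ← trans (sym (ℕₚ.+-identityʳ i)) i≡p =
    tick-then (N siteCount ℕₚ.≤? N siteIndex) refl
      (ℕₚ.≤-reflexive (trans (proj₁ (proj₂ constants)) (sym index≡)))
      (scan n marking
        -- `bestCost` still holds its initial `0ᴿ`, which gives the second alternative of `found`.
        (record { constants = constants ; position = vertex≡ ; dominates = λ _ _ ()
                ; found = inj₂ (≤ᴿ-refl 0ᴿ , λ _ _ → z≤n) })
        refl)
  mark (suc k) {i} {N} {M} constants@(_ , count≡ , one≡ , two≡) index≡ vertex≡ marking i+1+k≡p =
    tick-else (N siteCount ℕₚ.≤? N siteIndex) refl
      (λ p≤i → ℕₚ.<⇒≱ i<p (subst (_≤ i) count≡ (subst (N siteCount ≤_) index≡ p≤i)))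
      (tick refl (tick refl (tick refl (tick refl (tick refl
        (mark k constants
          (trans (cong₂ _+_ index≡ one≡) (ℕₚ.+-comm i 1)) vertex≡
          (Marking-step (sites I) j (Finₚ.toℕ-fromℕ< i<p) address≡ two≡ marking)
          1+i+k≡p))))))
    where
    1+i+k≡p : suc i + k ≡ p
    1+i+k≡p = trans (sym (ℕₚ.+-suc i k)) i+1+k≡p

    i<p : i < p
    i<p = ℕₚ.m+n≤o⇒m≤o (suc i) (ℕₚ.≤-reflexive 1+i+k≡p)

    j : Fin p
    j = fromℕ< i<p

    address≡ : N siteCount + M (N siteIndex) ≡ p + toℕ (lookup (sites I) j)
    address≡ = cong₂ _+_ count≡
      (trans (cong M (trans index≡ (sym (Finₚ.toℕ-fromℕ< i<p)))) (sites-stored marking j))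

  Marking-initial : Marking (sites I) 0 (memN (initial I))
  Marking-initial = record
    { sites-stored = nth-site (sites I) _
    ; marked       = λ _ ()
    -- Everything stored behind the sites is a bit, and so is the default 0, so the bound holds at
    -- any offset.
    ; unmarked     = λ v _ → subst (_< 2) (sym (nth-afterSites (sites I) _ (toℕ v)))
        (nth-All {P = _< 2} (s≤s z≤n) (Allₚ.concat⁺ (Allₚ.map⁺ (All.universal (λ u →
          Allₚ.map⁺ (All.universal (λ w → bit<2 (does (adj? (graph I) u w))) (allFin n)))
          (allFin n)))) (toℕ v))
    }
    where
    bit<2 : ∀ b → (if b then 1 else 0) < 2
    bit<2 true  = s≤s (s≤s z≤n)
    bit<2 false = s≤s z≤n

  -- Makes the marking loop linear in `n`: distinct sites inject into the vertices.
  p≤n : p ≤ n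
  p≤n = Finₚ.injective⇒≤ (lookup-injective (distinct I) _ _)

  1≤n : 1 ≤ n
  1≤n = ℕₚ.≤-trans (s≤s z≤n) (Finₚ.toℕ<n (proj₁ (hasNonSite I)))

  -- Marking gives `6 * p`, scanning `10 * n`, and the additive constants total 6, absorbed into
  -- `6 * n` because `n` is positive; 22 is 6 + 6 + 10.
  totalTime : 2 + markTime p ≤ 22 * n
  totalTime = begin
    2 + (p * 6 + (1 + (n * 10 + 3)))
      ≡⟨ solve 2 (λ p n → con 2 :+ (p :* con 6 :+ (con 1 :+ (n :* con 10 :+ con 3)))
                       := con 6 :* p :+ (con 6 :+ con 10 :* n)) refl p n ⟩
    6 * p + (6 * 1 + 10 * n)
      ≤⟨ ℕₚ.+-mono-≤ (ℕₚ.*-monoʳ-≤ 6 p≤n) (ℕₚ.+-monoˡ-≤ (10 * n) (ℕₚ.*-monoʳ-≤ 6 1≤n)) ⟩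
    6 * n + (6 * n + 10 * n)
      ≡⟨ solve 1 (λ n → con 6 :* n :+ (con 6 :* n :+ con 10 :* n) := con 22 :* n) refl n ⟩
    22 * n ∎
    where
    open ℕₚ.≤-Reasoning
    open +-*-Solver

  solves : SolvesWithin em scanMaxNonSite I (22 * n)
  solves = weaken totalTime (tick refl (tick refl
    (mark p (refl , refl , refl , refl) refl refl Marking-initial refl)))

lemma3p1 : Σ Program λ P → Σ ℕ λ c →
    (em : ExcludedMiddle 0ℓ) →
    ∀ {n p} (I : Instance n p) → IsClique (graph I) →
    SolvesWithin em P I (c * n)
lemma3p1 = scanMaxNonSite , 22 , Correctness.solves
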